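{- For every $r>1$ there exist $N_0(r)\in\mathbb{N}$ and a constant $C_r>0$ (both depending only on $r$) such that the following holds. Let $(a_n)_{n\in\mathbb{N}}$ be an increasing sequence of positive integers which is lacunary with growth factor $r$, and let $N\ge N_0(r)$. Then there exists $\alpha\in\mathbb{R}$ (which may depend on $N$) such that $$G(\{\alpha a_n\}_{n\le N})\le C_r\,\frac{\log N}{N}.$$
   Context: A sequence $(a_n)_{n\in\mathbb{N}}$ is lacunary with growth factor $r>1$ if $a_{n+1}\ge r a_n$ for every $n\in\mathbb{N}$. Maximal gap: for a finite family of real numbers $z_1,\dots,z_m$ ($m\ge1$), reduce each $z_i$ modulo $1$ to a representative in $[0,1)$ and sort these representatives as $0\le y_1\le y_2\le\dots\le y_m<1$; put $y_{m+1}:=1+y_1$. Then $G(\{z_i\}_{i\le m}):=\max_{2\le k\le m+1}(y_k-y_{k-1})$ is the largest gap between neighbouring points on the unit torus. Thus $G(\{\alpha a_n\}_{n\le N})$ is the maximal gap of the points $\alpha a_1,\dots,\alpha a_N$ modulo $1$. -}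

module Defs where

open import Data.Fin.Base as Fin using (Fin; inject₁)
open import Data.Fin.Permutation using (Permutation′; _⟨$⟩ʳ_)
open import Data.Fin.Relation.Unary.Top using (view; ‵fromℕ; ‵inject₁)
open import Data.Integer.Base as ℤ using (ℤ; +_; 1ℤ)
import Data.Integer.Properties as ℤ
import Data.Integer.Tactic.RingSolver as ℤ-Ring
open import Data.Nat.Base as ℕ using (ℕ; zero; suc; NonZero)
import Data.Nat.Properties as ℕ
open import Data.Nat.Tactic.RingSolver using (solve-∀)
open import Data.Product.Base using (Σ-syntax; ∃-syntax; _×_; _,_)
open import Data.Rational.Base as ℚ using (ℚ; 0ℚ; 1ℚ; ½; ∣_∣; toℚᵘ; *<*; mkℚ)
import Data.Rational.Properties as ℚ
open import Data.Rational.Solver using (module +-*-Solver)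
import Data.Rational.Unnormalised.Base as ℚᵘ
import Data.Rational.Unnormalised.Properties as ℚᵘ
open import Data.Sum.Base using (inj₁; inj₂)
open import Data.Vec.Functional using (Vector; foldr; head; tail)
open import Relation.Binary.Core using (_Preserves_⟶_)
open import Relation.Binary.PropositionalEquality
  using (_≡_; refl; sym; trans; cong; cong₂; subst; subst₂)

private
  variable
    n : ℕ

------------------------------------------------------------------------
-- Real numbers

Cauchy : (ℕ → ℚ) → Set
Cauchy x = ∀ ε → 0ℚ ℚ.< ε →
  ∃[ M ] (∀ m n → M ℕ.≤ m → M ℕ.≤ n → ∣ x m ℚ.- x n ∣ ℚ.< ε)

-- A real is a Cauchy sequence of rationals with no prescribed rate of
-- convergence. Equality of reals is _≈_, not _≡_.
record ℝ : Set where
  constructor mkℝ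
  field
    seq    : ℕ → ℚ
    cauchy : Cauchy seq

open ℝ public

infix 4 _≈_ _≤_ _<_

_≈_ : ℝ → ℝ → Set
x ≈ y = ∀ ε → 0ℚ ℚ.< ε →
  ∃[ M ] (∀ n → M ℕ.≤ n → ∣ seq x n ℚ.- seq y n ∣ ℚ.< ε)

_≤_ : ℝ → ℝ → Set
x ≤ y = ∀ ε → 0ℚ ℚ.< ε →
  ∃[ M ] (∀ n → M ℕ.≤ n → seq x n ℚ.≤ seq y n ℚ.+ ε)

_<_ : ℝ → ℝ → Set
x < y = ∃[ ε ] (0ℚ ℚ.< ε ×
  ∃[ M ] (∀ n → M ℕ.≤ n → seq x n ℚ.+ ε ℚ.≤ seq y n))

private
  open +-*-Solver using (solve; _:+_; _:*_; :-_; _:-_; _:=_; con)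

  ∣p-q∣<ε⇒p<q+ε : ∀ {p q ε} → ∣ p ℚ.- q ∣ ℚ.< ε → p ℚ.< q ℚ.+ ε
  ∣p-q∣<ε⇒p<q+ε {p} {q} {ε} h =
    subst (ℚ._< q ℚ.+ ε) (solve 2 (λ p q → q :+ (p :- q) := p) refl p q)
      (ℚ.+-monoʳ-< q (ℚ.≤-<-trans p≤∣p∣ h))
    where
    p≤∣p∣ : ∀ {p} → p ℚ.≤ ∣ p ∣
    p≤∣p∣ {p} with ℚ.≤-total 0ℚ p
    ... | inj₁ 0≤p = ℚ.≤-reflexive (sym (ℚ.0≤p⇒∣p∣≡p 0≤p))
    ... | inj₂ p≤0 = ℚ.≤-trans p≤0 (ℚ.0≤∣p∣ p)

  p<q+ε∧q<p+ε⇒∣p-q∣<ε : ∀ {p q ε} → p ℚ.< q ℚ.+ ε → q ℚ.< p ℚ.+ ε →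
                         ∣ p ℚ.- q ∣ ℚ.< ε
  p<q+ε∧q<p+ε⇒∣p-q∣<ε {p} {q} {ε} h k with ℚ.∣p∣≡p∨∣p∣≡-p (p ℚ.- q)
  ... | inj₁ e = subst₂ ℚ._<_ (sym e)
        (solve 2 (λ q ε → (q :+ ε) :- q := ε) refl q ε)
        (ℚ.+-monoˡ-< (ℚ.- q) h)
  ... | inj₂ e = subst₂ ℚ._<_
        (trans (solve 2 (λ p q → q :- p := :- (p :- q)) refl p q) (sym e))
        (solve 2 (λ p ε → (p :+ ε) :- p := ε) refl p ε)
        (ℚ.+-monoˡ-< (ℚ.- p) k)

  fromOneSided : {x : ℕ → ℚ} →
    (∀ ε → 0ℚ ℚ.< ε →
      ∃[ M ] (∀ m n → M ℕ.≤ m → M ℕ.≤ n → x m ℚ.< x n ℚ.+ ε)) →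
    Cauchy x
  fromOneSided {x} h ε ε>0 with h ε ε>0
  ... | M , H = M , λ m n M≤m M≤n →
        p<q+ε∧q<p+ε⇒∣p-q∣<ε {x m} {x n} (H m n M≤m M≤n) (H n m M≤n M≤m)

fromℚ : ℚ → ℝ
fromℚ q = mkℝ (λ _ → q) λ ε ε>0 → 0 , λ _ _ _ _ →
  subst (λ d → ∣ d ∣ ℚ.< ε) (sym (ℚ.+-inverseʳ q)) ε>0

fromℤ : ℤ → ℝ
fromℤ i = fromℚ (i ℚ./ 1)

fromℕ : ℕ → ℝ
fromℕ n = fromℤ (+ n)

0ℝ 1ℝ : ℝ
0ℝ = fromℕ 0
1ℝ = fromℕ 1

infix  8 -_
infixl 7 _*_ _/_
infixl 6 _+_ _-_ _⊔_

_+_ : ℝ → ℝ → ℝ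
x + y = mkℝ (λ n → seq x n ℚ.+ seq y n) (fromOneSided bound)
  where
  bound : ∀ ε → 0ℚ ℚ.< ε → ∃[ M ] (∀ m n → M ℕ.≤ m → M ℕ.≤ n →
    seq x m ℚ.+ seq y m ℚ.< (seq x n ℚ.+ seq y n) ℚ.+ ε)
  bound ε ε>0
    with cauchy x (½ ℚ.* ε) (ℚ.*-monoʳ-<-pos ½ ε>0)
       | cauchy y (½ ℚ.* ε) (ℚ.*-monoʳ-<-pos ½ ε>0)
  ... | M , H | L , K = M ℕ.⊔ L , λ m n p q →
    subst (seq x m ℚ.+ seq y m ℚ.<_)
      (solve 3 (λ a b ε → (a :+ con ½ :* ε) :+ (b :+ con ½ :* ε)
                            := (a :+ b) :+ ε) refl (seq x n) (seq y n) ε)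
      (ℚ.+-mono-<
        (∣p-q∣<ε⇒p<q+ε {seq x m} {seq x n} (H m n (ℕ.m⊔n≤o⇒m≤o M L p) (ℕ.m⊔n≤o⇒m≤o M L q)))
        (∣p-q∣<ε⇒p<q+ε {seq y m} {seq y n} (K m n (ℕ.m⊔n≤o⇒n≤o M L p) (ℕ.m⊔n≤o⇒n≤o M L q))))

-_ : ℝ → ℝ
- x = mkℝ (λ n → ℚ.- seq x n) λ ε ε>0 →
  let M , H = cauchy x ε ε>0 in M , λ m n p q →
    subst (ℚ._< ε)
      (cong ∣_∣ (solve 2 (λ a b → b :- a := (:- a) :- (:- b)) refl
                  (seq x m) (seq x n)))
      (H n m q p)

_-_ : ℝ → ℝ → ℝ
x - y = x + (- y)

_⊔_ : ℝ → ℝ → ℝ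
x ⊔ y = mkℝ (λ n → seq x n ℚ.⊔ seq y n) (fromOneSided bound)
  where
  bound : ∀ ε → 0ℚ ℚ.< ε → ∃[ M ] (∀ m n → M ℕ.≤ m → M ℕ.≤ n →
    seq x m ℚ.⊔ seq y m ℚ.< (seq x n ℚ.⊔ seq y n) ℚ.+ ε)
  bound ε ε>0 with cauchy x ε ε>0 | cauchy y ε ε>0
  ... | M , H | L , K = M ℕ.⊔ L , go
    where
    go : ∀ m n → M ℕ.⊔ L ℕ.≤ m → M ℕ.⊔ L ℕ.≤ n →
         seq x m ℚ.⊔ seq y m ℚ.< (seq x n ℚ.⊔ seq y n) ℚ.+ ε
    go m n p q with ℚ.⊔-sel (seq x m) (seq y m)
    ... | inj₁ e = subst (ℚ._< _) (sym e) (ℚ.<-≤-trans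
          (∣p-q∣<ε⇒p<q+ε {seq x m} {seq x n} (H m n (ℕ.m⊔n≤o⇒m≤o M L p) (ℕ.m⊔n≤o⇒m≤o M L q)))
          (ℚ.+-monoˡ-≤ ε (ℚ.p≤p⊔q (seq x n) (seq y n))))
    ... | inj₂ e = subst (ℚ._< _) (sym e) (ℚ.<-≤-trans
          (∣p-q∣<ε⇒p<q+ε {seq y m} {seq y n} (K m n (ℕ.m⊔n≤o⇒n≤o M L p) (ℕ.m⊔n≤o⇒n≤o M L q)))
          (ℚ.+-monoˡ-≤ ε (ℚ.p≤q⊔p (seq x n) (seq y n))))

private
  eventuallyBounded : ∀ x → Σ[ B ∈ ℚ ] (0ℚ ℚ.< B ×
    ∃[ M ] (∀ n → M ℕ.≤ n → ∣ seq x n ∣ ℚ.< B))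
  eventuallyBounded x with cauchy x 1ℚ (ℚ.positive⁻¹ 1ℚ)
  ... | M , H = ∣ seq x M ∣ ℚ.+ 1ℚ
              , ℚ.+-mono-≤-< (ℚ.0≤∣p∣ (seq x M)) (ℚ.positive⁻¹ 1ℚ)
              , M , λ n M≤n → ℚ.≤-<-trans
                  (ℚ.≤-trans
                    (ℚ.≤-reflexive (cong ∣_∣
                      (solve 2 (λ a b → a := b :+ (a :- b)) refl
                        (seq x n) (seq x M))))
                    (ℚ.∣p+q∣≤∣p∣+∣q∣ (seq x M) (seq x n ℚ.- seq x M)))
                  (ℚ.+-monoʳ-< ∣ seq x M ∣ (H n M M≤n ℕ.≤-refl))

  *-bound : ∀ {p q B δ} → 0ℚ ℚ.< B → ∣ p ∣ ℚ.< B → ∣ q ∣ ℚ.< δ →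
            ∣ p ℚ.* q ∣ ℚ.< B ℚ.* δ
  *-bound {p} {q} {B} {δ} B>0 p<B q<δ = begin-strict
    ∣ p ℚ.* q ∣      ≡⟨ ℚ.∣p*q∣≡∣p∣*∣q∣ p q ⟩
    ∣ p ∣ ℚ.* ∣ q ∣  ≤⟨ ℚ.*-monoʳ-≤-nonNeg ∣ q ∣ {{ℚ.∣-∣-nonNeg q}} (ℚ.<⇒≤ p<B) ⟩
    B ℚ.* ∣ q ∣      <⟨ ℚ.*-monoʳ-<-pos B {{ℚ.positive B>0}} q<δ ⟩
    B ℚ.* δ          ∎
    where open ℚ.≤-Reasoning

  divide : ∀ D ε → 0ℚ ℚ.< D → 0ℚ ℚ.< ε → Σ[ δ ∈ ℚ ] (0ℚ ℚ.< δ × D ℚ.* δ ≡ ε)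
  divide D ε D>0 ε>0 = δ , δ>0 , D*δ≡ε
    where
    instance
      D-pos : ℚ.Positive D
      D-pos = ℚ.positive D>0
      D-nonZero : ℚ.NonZero D
      D-nonZero = ℚ.pos⇒nonZero D
    δ = (ℚ.1/ D) ℚ.* ε
    δ>0 : 0ℚ ℚ.< δ
    δ>0 = subst (ℚ._< δ) (ℚ.*-zeroʳ (ℚ.1/ D))
            (ℚ.*-monoʳ-<-pos (ℚ.1/ D) {{ℚ.1/pos⇒pos D}} ε>0)
    D*δ≡ε : D ℚ.* δ ≡ ε
    D*δ≡ε = trans (sym (ℚ.*-assoc D (ℚ.1/ D) ε))
           (trans (cong (ℚ._* ε) (ℚ.*-inverseʳ D)) (ℚ.*-identityˡ ε))

  *-close : ∀ {a b c d B C δ ε} → 0ℚ ℚ.< B → 0ℚ ℚ.< C → (B ℚ.+ C) ℚ.* δ ≡ ε →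
            ∣ a ∣ ℚ.< B → ∣ d ∣ ℚ.< C →
            ∣ a ℚ.- c ∣ ℚ.< δ → ∣ b ℚ.- d ∣ ℚ.< δ →
            ∣ a ℚ.* b ℚ.- c ℚ.* d ∣ ℚ.< ε
  *-close {a} {b} {c} {d} {B} {C} {δ} {ε} B>0 C>0 e a<B d<C ac bd = begin-strict
    ∣ a ℚ.* b ℚ.- c ℚ.* d ∣
      ≡⟨ cong ∣_∣ (solve 4 (λ a b c d →
           a :* b :- c :* d := a :* (b :- d) :+ d :* (a :- c)) refl a b c d) ⟩
    ∣ a ℚ.* (b ℚ.- d) ℚ.+ d ℚ.* (a ℚ.- c) ∣
      ≤⟨ ℚ.∣p+q∣≤∣p∣+∣q∣ (a ℚ.* (b ℚ.- d)) (d ℚ.* (a ℚ.- c)) ⟩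
    ∣ a ℚ.* (b ℚ.- d) ∣ ℚ.+ ∣ d ℚ.* (a ℚ.- c) ∣
      <⟨ ℚ.+-mono-< (*-bound {a} {b ℚ.- d} B>0 a<B bd)
                    (*-bound {d} {a ℚ.- c} C>0 d<C ac) ⟩
    B ℚ.* δ ℚ.+ C ℚ.* δ
      ≡⟨ ℚ.*-distribʳ-+ δ B C ⟨
    (B ℚ.+ C) ℚ.* δ
      ≡⟨ e ⟩
    ε ∎
    where open ℚ.≤-Reasoning

_*_ : ℝ → ℝ → ℝ
x * y = mkℝ (λ n → seq x n ℚ.* seq y n) λ ε ε>0 →
  let B , B>0 , M₁ , H₁ = eventuallyBounded x
      C , C>0 , M₂ , H₂ = eventuallyBounded y
      δ , δ>0 , e       = divide (B ℚ.+ C) ε (ℚ.+-mono-< B>0 C>0) ε>0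
      M₃ , H₃           = cauchy x δ δ>0
      M₄ , H₄           = cauchy y δ δ>0
      M                 = (M₁ ℕ.⊔ M₂) ℕ.⊔ (M₃ ℕ.⊔ M₄)
  in M , λ m n p q →
    let p₁₂ = ℕ.m⊔n≤o⇒m≤o (M₁ ℕ.⊔ M₂) (M₃ ℕ.⊔ M₄) p
        p₃₄ = ℕ.m⊔n≤o⇒n≤o (M₁ ℕ.⊔ M₂) (M₃ ℕ.⊔ M₄) p
        q₁₂ = ℕ.m⊔n≤o⇒m≤o (M₁ ℕ.⊔ M₂) (M₃ ℕ.⊔ M₄) q
        q₃₄ = ℕ.m⊔n≤o⇒n≤o (M₁ ℕ.⊔ M₂) (M₃ ℕ.⊔ M₄) q
    in *-close {seq x m} {seq y m} {seq x n} {seq y n} B>0 C>0 e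
         (H₁ m (ℕ.m⊔n≤o⇒m≤o M₁ M₂ p₁₂)) (H₂ n (ℕ.m⊔n≤o⇒n≤o M₁ M₂ q₁₂))
         (H₃ m n (ℕ.m⊔n≤o⇒m≤o M₃ M₄ p₃₄) (ℕ.m⊔n≤o⇒m≤o M₃ M₄ q₃₄))
         (H₄ m n (ℕ.m⊔n≤o⇒n≤o M₃ M₄ p₃₄) (ℕ.m⊔n≤o⇒n≤o M₃ M₄ q₃₄))

_/_ : ℝ → (n : ℕ) → .{{_ : NonZero n}} → ℝ
x / n = x * fromℚ (1ℤ ℚ./ n)

------------------------------------------------------------------------
-- The natural logarithm of a positive integer

-- reciprocals m n = 1/(m+1) + 1/(m+2) + … + 1/(m+n)
reciprocals : ℕ → ℕ → ℚ
reciprocals m zero    = 0ℚ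
reciprocals m (suc n) = reciprocals m n ℚ.+ 1ℤ ℚ./ suc (m ℕ.+ n)

private
  R = reciprocals

  /-mono : ∀ i j d e → i ℤ.* + suc e ℤ.≤ j ℤ.* + suc d →
           i ℚ./ suc d ℚ.≤ j ℚ./ suc e
  /-mono i j d e h = ℚ.toℚᵘ-cancel-≤
    (ℚᵘ.≤-respˡ-≃ (ℚᵘ.≃-sym (ℚ.toℚᵘ-fromℚᵘ (ℚᵘ.mkℚᵘ i d)))
    (ℚᵘ.≤-respʳ-≃ (ℚᵘ.≃-sym (ℚ.toℚᵘ-fromℚᵘ (ℚᵘ.mkℚᵘ j e)))
      (ℚᵘ.*≤* h)))

  1/-anti : ∀ {d e} → e ℕ.≤ d → 1ℤ ℚ./ suc d ℚ.≤ 1ℤ ℚ./ suc e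
  1/-anti {d} {e} h = /-mono 1ℤ 1ℤ d e
    (ℤ.*-monoˡ-≤-nonNeg 1ℤ (ℤ.+≤+ (ℕ.s≤s h)))

  /-+ : ∀ c d → + c ℚ./ suc d ℚ.+ 1ℤ ℚ./ suc d ≡ + suc c ℚ./ suc d
  /-+ c d = ℚ.toℚᵘ-injective (begin
    toℚᵘ (+ c ℚ./ suc d ℚ.+ 1ℤ ℚ./ suc d)
      ≈⟨ ℚ.toℚᵘ-homo-+ (+ c ℚ./ suc d) (1ℤ ℚ./ suc d) ⟩
    toℚᵘ (+ c ℚ./ suc d) ℚᵘ.+ toℚᵘ (1ℤ ℚ./ suc d)
      ≈⟨ ℚᵘ.+-cong (ℚ.toℚᵘ-fromℚᵘ (ℚᵘ.mkℚᵘ (+ c) d))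
                   (ℚ.toℚᵘ-fromℚᵘ (ℚᵘ.mkℚᵘ 1ℤ d)) ⟩
    ℚᵘ.mkℚᵘ (+ c) d ℚᵘ.+ ℚᵘ.mkℚᵘ 1ℤ d
      ≈⟨ ℚᵘ.*≡* (lem (+ c) (+ suc d)) ⟩
    ℚᵘ.mkℚᵘ (+ suc c) d
      ≈⟨ ℚ.toℚᵘ-fromℚᵘ (ℚᵘ.mkℚᵘ (+ suc c) d) ⟨
    toℚᵘ (+ suc c ℚ./ suc d) ∎)
    where
    open ℚᵘ.≃-Reasoning
    lem : ∀ c s → (c ℤ.* s ℤ.+ 1ℤ ℤ.* s) ℤ.* s ≡ (1ℤ ℤ.+ c) ℤ.* (s ℤ.* s)
    lem = ℤ-Ring.solve-∀

  /-cancel : ∀ q p → + suc p ℚ./ (suc q ℕ.* suc p) ≡ 1ℤ ℚ./ suc q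
  /-cancel q p = ℚ.≤-antisym
    (/-mono (+ suc p) 1ℤ (p ℕ.+ q ℕ.* suc p) q
      (ℤ.≤-reflexive (cong +_ (lem (suc p) (suc q)))))
    (/-mono 1ℤ (+ suc p) q (p ℕ.+ q ℕ.* suc p)
      (ℤ.≤-reflexive (cong +_ (sym (lem (suc p) (suc q))))))
    where
    lem : ∀ p q → p ℕ.* q ≡ q ℕ.* p ℕ.+ 0
    lem = solve-∀

  R-split : ∀ a b c → R a (b ℕ.+ c) ≡ R a b ℚ.+ R (a ℕ.+ b) c
  R-split a b zero    = trans (cong (R a) (ℕ.+-identityʳ b))
                              (sym (ℚ.+-identityʳ (R a b)))
  R-split a b (suc c) = trans (cong (R a) (ℕ.+-suc b c))
    (trans (cong₂ ℚ._+_ (R-split a b c)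
             (cong (λ k → 1ℤ ℚ./ suc k) (sym (ℕ.+-assoc a b c))))
           (ℚ.+-assoc (R a b) (R (a ℕ.+ b) c) _))

  R-lower : ∀ a c d → a ℕ.+ c ℕ.≤ suc d → + c ℚ./ suc d ℚ.≤ R a c
  R-lower a zero    d h = ℚ.≤-reflexive (ℚ.≤-antisym
    (/-mono (+ 0) (+ 0) d 0 ℤ.≤-refl) (/-mono (+ 0) (+ 0) 0 d ℤ.≤-refl))
  R-lower a (suc c) d h = subst (ℚ._≤ R a (suc c)) (/-+ c d)
    (ℚ.+-mono-≤ (R-lower a c d (ℕ.≤-trans (ℕ.+-monoʳ-≤ a (ℕ.n≤1+n c)) h))
      (1/-anti (ℕ.s≤s⁻¹ (subst (ℕ._≤ suc d) (ℕ.+-suc a c) h))))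

  R-upper : ∀ a c d → suc d ℕ.≤ a → R a c ℚ.≤ + c ℚ./ suc d
  R-upper a zero    d h = /-mono (+ 0) (+ 0) 0 d ℤ.≤-refl
  R-upper a (suc c) d h = subst (R a (suc c) ℚ.≤_) (/-+ c d)
    (ℚ.+-mono-≤ (R-upper a c d h)
      (1/-anti (ℕ.≤-trans (ℕ.n≤1+n d) (ℕ.≤-trans h (ℕ.m≤m+n a c)))))

  R-refine : ∀ m n p → R (m ℕ.* p) (suc n ℕ.* p) ≡
             R (m ℕ.* p) (n ℕ.* p) ℚ.+ R ((m ℕ.+ n) ℕ.* p) p
  R-refine m n p = trans (cong (R (m ℕ.* p)) (ℕ.+-comm p (n ℕ.* p)))
    (trans (R-split (m ℕ.* p) (n ℕ.* p) p)
      (cong (λ k → R (m ℕ.* p) (n ℕ.* p) ℚ.+ R k p)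
        (sym (ℕ.*-distribʳ-+ p m n))))

  R≤refined : ∀ m n p → R m n ℚ.≤ R (m ℕ.* suc p) (n ℕ.* suc p)
  R≤refined m zero    p = ℚ.≤-refl
  R≤refined m (suc n) p = subst (R m (suc n) ℚ.≤_) (sym (R-refine m n (suc p)))
    (ℚ.+-mono-≤ (R≤refined m n p)
      (subst (ℚ._≤ R (k ℕ.* suc p) (suc p)) (/-cancel k p)
        (R-lower (k ℕ.* suc p) (suc p) (p ℕ.+ k ℕ.* suc p)
          (ℕ.≤-reflexive (ℕ.+-comm (k ℕ.* suc p) (suc p))))))
    where k = m ℕ.+ n

  refined≤R : ∀ m n p → R (suc m ℕ.* suc p) (n ℕ.* suc p) ℚ.≤ R m n
  refined≤R m zero    p = ℚ.≤-refl
  refined≤R m (suc n) p = subst (ℚ._≤ R m (suc n)) (sym (R-refine (suc m) n (suc p)))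
    (ℚ.+-mono-≤ (refined≤R m n p)
      (subst (R (suc k ℕ.* suc p) (suc p) ℚ.≤_) (/-cancel k p)
        (R-upper (suc k ℕ.* suc p) (suc p) (p ℕ.+ k ℕ.* suc p) ℕ.≤-refl)))
    where k = m ℕ.+ n

  R-shift : ∀ m n → R m n ℚ.+ 1ℤ ℚ./ suc (m ℕ.+ n) ≡ R (suc m) n ℚ.+ 1ℤ ℚ./ suc m
  R-shift m zero    = cong (λ k → 0ℚ ℚ.+ 1ℤ ℚ./ suc k) (ℕ.+-identityʳ m)
  R-shift m (suc n) = trans
    (cong₂ ℚ._+_ (R-shift m n) (cong (λ k → 1ℤ ℚ./ suc k) (ℕ.+-suc m n)))
    (solve 3 (λ a b c → (a :+ b) :+ c := (a :+ c) :+ b) refl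
      (R (suc m) n) (1ℤ ℚ./ suc m) (1ℤ ℚ./ suc (suc (m ℕ.+ n))))

  R≤shifted : ∀ m n → R m n ℚ.≤ R (suc m) n ℚ.+ 1ℤ ℚ./ suc m
  R≤shifted m n = subst₂ ℚ._≤_ (ℚ.+-identityʳ (R m n)) (R-shift m n)
    (ℚ.+-monoʳ-≤ (R m n) (/-mono (+ 0) 1ℤ 0 (m ℕ.+ n) (ℤ.+≤+ ℕ.z≤n)))

  archimedean : ∀ ε → 0ℚ ℚ.< ε → ∃[ M ] (1ℤ ℚ./ suc M ℚ.< ε)
  archimedean ε@(mkℚ (+ suc i) d _) ε>0 = suc d ,
    ℚ.toℚᵘ-cancel-< (ℚᵘ.<-respˡ-≃
      (ℚᵘ.≃-sym (ℚ.toℚᵘ-fromℚᵘ (ℚᵘ.mkℚᵘ 1ℤ (suc d))))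
      (ℚᵘ.*<* (ℤ.+<+ (ℕ.≤-trans
        (ℕ.≤-reflexive (cong (2 ℕ.+_) (ℕ.+-identityʳ d)))
        (ℕ.m≤m+n (suc (suc d)) (i ℕ.* suc (suc d)))))))
  archimedean (mkℚ (+ 0)      _ _) (*<* (ℤ.+<+ ()))
  archimedean (mkℚ ℤ.-[1+ _ ] _ _) (*<* ())

-- log N = ∫₁ᴺ dt/t as the limit of right Riemann sums with step 1/m, where
-- m = k + 1: the sum of (1/m) · 1/(1 + i/m) = 1/(m + i) over
-- 1 ≤ i ≤ (N - 1) m.
log : (N : ℕ) → .{{_ : NonZero N}} → ℝ
log N = mkℝ s (fromOneSided λ ε ε>0 →
  let M , 1/M<ε = archimedean ε ε>0 in
  M , λ k l _ M≤l → ℚ.≤-<-trans (s-bound k l)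
        (ℚ.+-monoʳ-< (s l) (ℚ.≤-<-trans (1/-anti M≤l) 1/M<ε)))
  where
  c = N ℕ.∸ 1

  s : ℕ → ℚ
  s k = reciprocals (suc k) (c ℕ.* suc k)

  s-bound : ∀ k l → s k ℚ.≤ s l ℚ.+ 1ℤ ℚ./ suc l
  s-bound k l = begin
    R (suc k) (c ℕ.* suc k)
      ≤⟨ R≤refined (suc k) (c ℕ.* suc k) l ⟩
    R (suc k ℕ.* suc l) (c ℕ.* suc k ℕ.* suc l)
      ≡⟨ cong₂ R (ℕ.*-comm (suc k) (suc l)) (lem c (suc k) (suc l)) ⟩
    R (suc l ℕ.* suc k) (c ℕ.* suc l ℕ.* suc k)
      ≤⟨ refined≤R l (c ℕ.* suc l) k ⟩
    R l (c ℕ.* suc l)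
      ≤⟨ R≤shifted l (c ℕ.* suc l) ⟩
    s l ℚ.+ 1ℤ ℚ./ suc l ∎
    where
    open ℚ.≤-Reasoning
    lem : ∀ c k l → c ℕ.* k ℕ.* l ≡ c ℕ.* l ℕ.* k
    lem = solve-∀

------------------------------------------------------------------------
-- Maximal gap modulo 1

-- The representatives in [0, 1) of z modulo 1, arranged in non-decreasing
-- order; σ sends the index of a point of z to the position of its
-- representative. Every z has such an arrangement classically, and any two
-- have the same y up to _≈_. The arrangement is kept as data because neither
-- the integer part nor the sorting of reals is computable.
record SortedMod1 (z : Vector ℝ n) : Set where
  field
    y      : Vector ℝ n
    ⌊_⌋    : Fin n → ℤ
    σ      : Permutation′ n
    y-mod1 : ∀ i → y (σ ⟨$⟩ʳ i) ≈ z i - fromℤ ⌊ i ⌋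
    0≤y    : ∀ j → 0ℝ ≤ y j
    y<1    : ∀ j → y j < 1ℝ
    sorted : y Preserves Fin._≤_ ⟶ _≤_

-- y₁, …, yₘ, 1 + y₁
wrapAround : Vector ℝ (suc n) → Vector ℝ (suc (suc n))
wrapAround y k with view k
... | ‵fromℕ     = 1ℝ + head y
... | ‵inject₁ j = y j

maximum : Vector ℝ (suc n) → ℝ
maximum v = foldr _⊔_ (head v) (tail v)

G : .{{_ : NonZero n}} → {z : Vector ℝ n} → SortedMod1 z → ℝ
G {n = suc _} s =
  maximum (λ k → wrapAround y (Fin.suc k) - wrapAround y (inject₁ k))
  where open SortedMod1 s

------------------------------------------------------------------------
-- Lacunary sequences

Lacunary : ℝ → (ℕ → ℕ) → Set
Lacunary r a = ∀ n → r * fromℕ (a n) ≤ fromℕ (a (suc n))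

module Submission where

open import Data.Empty using (⊥-elim)
open import Data.Fin.Base as Fin using (Fin; toℕ; zero; suc; fromℕ<; inject₁; punchIn)
import Data.Fin.Properties as Fin
open import Data.Fin.Permutation using (Permutation′; _⟨$⟩ʳ_; _⟨$⟩ˡ_; insert; id; inverseˡ)
open import Data.Fin.Relation.Unary.Top using (view; ‵fromℕ; ‵inject₁; view-inject₁)
open import Data.Integer.Base as ℤ using (+_)
import Data.Integer.Properties as ℤ
open import Data.Nat.Base as ℕ using (ℕ; zero; suc; NonZero; z≤n; s≤s; s≤s⁻¹)
import Data.Nat.DivMod as ℕ
import Data.Nat.Properties as ℕ
open import Data.Nat.Tactic.RingSolver using (solve-∀)
open import Data.Product.Base using (Σ-syntax; ∃-syntax; _×_; _,_; proj₁; proj₂)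
open import Data.Rational.Base as ℚ using (ℚ; 0ℚ; mkℚ; *<*)
import Data.Rational.Properties as ℚ
open import Data.Rational.Solver using (module +-*-Solver)
import Data.Rational.Unnormalised.Base as ℚᵘ
import Data.Rational.Unnormalised.Properties as ℚᵘ
open import Data.Sum.Base using (inj₁; inj₂)
open import Data.Vec.Functional using (Vector; foldr)
open import Relation.Binary.Core using (_Preserves_⟶_)
open import Relation.Binary.PropositionalEquality
  using (_≡_; refl; sym; trans; cong; cong₂; subst; subst₂; module ≡-Reasoning)
open import Relation.Nullary using (yes; no)

open +-*-Solver using (solve; _:+_; _:-_; _:=_)

-- If 1 + 1/q ≤ r, then a (n + q) ≥ 2 a n by Bernoulli's inequality. Keep only
-- every m-th term, m = (2 + u) q with 2 ^ u ≤ N < 2 ^ (u + 1); there are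
-- K ≥ N / m of them, b 0, …, b (K - 1), and b (k + 1) ≥ 2 K b k. Hence nested
-- intervals give one α for which α b k mod 1 lies in the k-th of the K equal
-- parts of the circle, for every k < K. All gaps are then at most
-- 2 / K ≤ 2 m / N, and m is of order log N. The left endpoint of the last
-- interval is a rational α, so the fractional parts can be computed and
-- sorted.

-- Nested intervals and residues in natural-number arithmetic

module Arithmetic where
  open import Data.Nat.Base using (_+_; _*_; _∸_; _^_; _≤_; _<_)
  open import Data.Nat.DivMod using (_/_; _%_)
  open ℕ.≤-Reasoning

  -- With denominators cleared, this is transitivity for p / c ≤ x / b ≤ y / d; only the middle
  -- denominator has to be cancelled.
  cross-trans : ∀ {p x y b c d} .{{_ : NonZero b}} →
                p * b ≤ x * c → x * d ≤ y * b → p * d ≤ y * c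
  cross-trans {p} {x} {y} {b} {c} {d} h k = ℕ.*-cancelʳ-≤ (p * d) (y * c) b (begin
    p * d * b  ≡⟨ swap p d b ⟩
    p * b * d  ≤⟨ ℕ.*-monoˡ-≤ d h ⟩
    x * c * d  ≡⟨ swap x c d ⟩
    x * d * c  ≤⟨ ℕ.*-monoˡ-≤ c k ⟩
    y * b * c  ≡⟨ swap y b c ⟩
    y * c * b  ∎)
    where
    swap : ∀ a b c → a * b * c ≡ a * c * b
    swap = solve-∀

  -- The point x / (K b k) reaches, for every j ≤ k, the j-th of the K equal
  -- parts of the circle after multiplication by b j. The interval
  -- [x / (K b k) , (x + 1) / (K b k)) contains two periods of b (k + 1), hence
  -- an interval of the same kind for k + 1.
  nested : ∀ K (b : ℕ → ℕ) → (∀ k → 0 < b k) → (∀ k → 2 * K * b k ≤ b (suc k)) →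
           ∀ k → k < K → ∃[ x ] (∀ j → j ≤ k → ∃[ p ]
             ((K * p + j) * b k ≤ x * b j × suc x * b j ≤ suc (K * p + j) * b k))
  nested K b b>0 grow zero    _   = 0 , λ { zero _ → 0 ,
    ℕ.≤-reflexive (cong (_* b 0) (K*0+0 K)) ,
    ℕ.≤-reflexive (cong (λ i → suc i * b 0) (sym (K*0+0 K))) }
    where
    K*0+0 : ∀ K → K * 0 + 0 ≡ 0
    K*0+0 = solve-∀
  nested K@(suc _) b b>0 grow (suc k) k<K with nested K b b>0 grow k (ℕ.<-trans (ℕ.n<1+n k) k<K)
  ... | x , h = x′ , hits
    where
    instance
      bk≢0 : NonZero (b k)
      bk≢0 = ℕ.>-nonZero (b>0 k)
      Kbk≢0 : NonZero (K * b k)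
      Kbk≢0 = ℕ.m*n≢0 K (b k)
    z = x * b (suc k)
    Q = z / (K * b k)
    -- `Q` is the integer part of `b (suc k)` times the left endpoint. The period starting at
    -- `suc Q` therefore lies wholly inside the scaled interval, and `x′` selects part number
    -- `suc k` of it.
    x′ = K * suc Q + suc k

    lower : x * b (suc k) ≤ x′ * b k
    lower = begin
      z                                     ≡⟨ ℕ.m≡m%n+[m/n]*n z (K * b k) ⟩
      z % (K * b k) + Q * (K * b k)         ≤⟨ ℕ.+-monoˡ-≤ _ (ℕ.<⇒≤ (ℕ.m%n<n z (K * b k))) ⟩
      K * b k + Q * (K * b k)               ≡⟨ lem K (b k) Q ⟩
      K * suc Q * b k                       ≤⟨ ℕ.*-monoˡ-≤ (b k) (ℕ.m≤m+n (K * suc Q) (suc k)) ⟩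
      x′ * b k                              ∎
      where
      lem : ∀ K b Q → K * b + Q * (K * b) ≡ K * (1 + Q) * b
      lem = solve-∀

    upper : suc x′ * b k ≤ suc x * b (suc k)
    upper = begin
      suc x′ * b k                          ≡⟨ cong (_* b k) (sym (ℕ.+-suc (K * suc Q) (suc k))) ⟩
      (K * suc Q + suc (suc k)) * b k       ≤⟨ ℕ.*-monoˡ-≤ (b k) (ℕ.+-monoʳ-≤ (K * suc Q) k<K) ⟩
      (K * suc Q + K) * b k                 ≡⟨ lem K (b k) Q ⟩
      2 * K * b k + Q * (K * b k)           ≤⟨ ℕ.+-mono-≤ (grow k) (ℕ.m/n*n≤m z (K * b k)) ⟩
      suc x * b (suc k)                     ∎
      where
      lem : ∀ K b Q → (K * (1 + Q) + K) * b ≡ 2 * K * b + Q * (K * b)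
      lem = solve-∀

    hits : ∀ j → j ≤ suc k → ∃[ p ]
      ((K * p + j) * b (suc k) ≤ x′ * b j × suc x′ * b j ≤ suc (K * p + j) * b (suc k))
    hits j j≤ with ℕ.m≤n⇒m<n∨m≡n j≤
    ... | inj₂ refl = suc Q , ℕ.≤-refl , ℕ.≤-refl
    -- Earlier parts stay hit: by `lower` and `upper` the new interval lies in the old one.
    ... | inj₁ j<   with h j (s≤s⁻¹ j<)
    ...   | p , l , u = p , cross-trans {K * p + j} {x} {x′} {b k} l lower
                          , cross-trans {suc x′} {suc x} {suc (K * p + j)} {b k} upper u

  -- Removing `p` full periods `K * b` from `z` leaves a number below `suc j * b`, hence below
  -- `K * b`; it must be the remainder.
  %-part : ∀ K b p j z .{{_ : NonZero (K * b)}} → j < K →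
           (K * p + j) * b ≤ z → z < suc (K * p + j) * b →
           j * b ≤ z % (K * b) × z % (K * b) < suc j * b
  %-part K b p j z j<K l u =
    subst (j * b ≤_) (sym z%) (ℕ.+-cancelˡ-≤ (p * (K * b)) _ _
      (subst₂ _≤_ (lem K p j b) (sym z≡) l)) ,
    subst (_< suc j * b) (sym z%) w<
    where
    lem : ∀ K p j b → (K * p + j) * b ≡ p * (K * b) + j * b
    lem = solve-∀
    lem′ : ∀ K p j b → (1 + (K * p + j)) * b ≡ p * (K * b) + (1 + j) * b
    lem′ = solve-∀
    w = z ∸ p * (K * b)
    z≡ : p * (K * b) + w ≡ z
    z≡ = ℕ.m+[n∸m]≡n (ℕ.≤-trans (ℕ.m≤m+n _ (j * b)) (subst (_≤ z) (lem K p j b) l))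
    w< : w < suc j * b
    w< = ℕ.+-cancelˡ-< (p * (K * b)) _ _ (subst₂ _<_ (sym z≡) (lem′ K p j b) u)
    z% : z % (K * b) ≡ w
    z% = begin-equality
      z % (K * b)                    ≡⟨ cong (_% (K * b)) (trans (sym z≡) (ℕ.+-comm _ w)) ⟩
      (w + p * (K * b)) % (K * b)    ≡⟨ ℕ.[m+kn]%n≡m%n w p (K * b) ⟩
      w % (K * b)                    ≡⟨ ℕ.m<n⇒m%n≡m (ℕ.<-≤-trans w< (ℕ.*-monoˡ-≤ b j<K)) ⟩
      w                              ∎

  -- Division bound, Bernoulli's inequality and repeated doubling

  m<[1+m/n]*n : ∀ m n .{{_ : NonZero n}} → m < suc (m / n) * n
  m<[1+m/n]*n m n = begin-strict
    m                    ≡⟨ ℕ.m≡m%n+[m/n]*n m n ⟩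
    m % n + m / n * n    <⟨ ℕ.+-monoˡ-< (m / n * n) (ℕ.m%n<n m n) ⟩
    n + m / n * n        ∎

  -- Bernoulli's inequality 1 + i/q ≤ (1 + 1/q)^i, multiplied by q^(i+1).
  bernoulli : ∀ q i → q ^ i * (q + i) ≤ q * suc q ^ i
  bernoulli q zero    = ℕ.≤-reflexive (lem q)
    where
    lem : ∀ q → 1 * (q + 0) ≡ q * 1
    lem = solve-∀
  bernoulli q (suc i) = begin
    q * q ^ i * (q + suc i)                  ≤⟨ ℕ.m≤m+n _ (q ^ i * i) ⟩
    q * q ^ i * (q + suc i) + q ^ i * i      ≡⟨ lem q i (q ^ i) ⟩
    suc q * (q ^ i * (q + i))                ≤⟨ ℕ.*-monoʳ-≤ (suc q) (bernoulli q i) ⟩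
    suc q * (q * suc q ^ i)                  ≡⟨ lem′ q (suc q ^ i) ⟩
    q * (suc q * suc q ^ i)                  ∎
    where
    lem : ∀ q i e → q * e * (q + (1 + i)) + e * i ≡ (1 + q) * (e * (q + i))
    lem = solve-∀
    lem′ : ∀ q e → (1 + q) * (q * e) ≡ q * ((1 + q) * e)
    lem′ = solve-∀

  -- Bernoulli's inequality at `i = q` says (1 + 1/q)^q ≥ 2, and `q` steps of growth gain that
  -- factor. Everything is multiplied by `q * q ^ q`, which is cancelled at the end.
  doubling : ∀ q .{{_ : NonZero q}} (a : ℕ → ℕ) → (∀ n → suc q * a n ≤ q * a (suc n)) →
             ∀ n → 2 * a n ≤ a (q + n)
  doubling q a step n = ℕ.*-cancelˡ-≤ (q * q ^ q) (begin
    q * q ^ q * (2 * a n)       ≡⟨ lem q (q ^ q) (a n) ⟩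
    q ^ q * (q + q) * a n       ≤⟨ ℕ.*-monoˡ-≤ (a n) (bernoulli q q) ⟩
    q * suc q ^ q * a n         ≡⟨ ℕ.*-assoc q (suc q ^ q) (a n) ⟩
    q * (suc q ^ q * a n)       ≤⟨ ℕ.*-monoʳ-≤ q (powers q) ⟩
    q * (q ^ q * a (q + n))     ≡⟨ ℕ.*-assoc q (q ^ q) (a (q + n)) ⟨
    q * q ^ q * a (q + n)       ∎)
    where
    instance
      qᵠ≢0 : NonZero (q ^ q)
      qᵠ≢0 = ℕ.m^n≢0 q q
      qqᵠ≢0 : NonZero (q * q ^ q)
      qqᵠ≢0 = ℕ.m*n≢0 q (q ^ q)
    lem : ∀ q e a → q * e * (2 * a) ≡ e * (q + q) * a
    lem = solve-∀
    swap : ∀ a b c → a * (b * c) ≡ b * (a * c)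
    swap = solve-∀
    powers : ∀ i → suc q ^ i * a n ≤ q ^ i * a (i + n)
    powers zero    = ℕ.≤-refl
    powers (suc i) = begin
      suc q * suc q ^ i * a n          ≡⟨ ℕ.*-assoc (suc q) (suc q ^ i) (a n) ⟩
      suc q * (suc q ^ i * a n)        ≤⟨ ℕ.*-monoʳ-≤ (suc q) (powers i) ⟩
      suc q * (q ^ i * a (i + n))      ≡⟨ swap (suc q) (q ^ i) (a (i + n)) ⟩
      q ^ i * (suc q * a (i + n))      ≤⟨ ℕ.*-monoʳ-≤ (q ^ i) (step (i + n)) ⟩
      q ^ i * (q * a (suc i + n))      ≡⟨ swap (q ^ i) q (a (suc i + n)) ⟩
      q * (q ^ i * a (suc i + n))      ≡⟨ ℕ.*-assoc q (q ^ i) (a (suc i + n)) ⟨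
      q * q ^ i * a (suc i + n)        ∎

  doublings : ∀ q (a : ℕ → ℕ) → (∀ n → 2 * a n ≤ a (q + n)) →
              ∀ t n → 2 ^ t * a n ≤ a (t * q + n)
  doublings q a double zero    n = ℕ.≤-reflexive (ℕ.+-identityʳ (a n))
  doublings q a double (suc t) n = begin
    2 * 2 ^ t * a n        ≡⟨ ℕ.*-assoc 2 (2 ^ t) (a n) ⟩
    2 * (2 ^ t * a n)      ≤⟨ ℕ.*-monoʳ-≤ 2 (doublings q a double t n) ⟩
    2 * a (t * q + n)      ≤⟨ double (t * q + n) ⟩
    a (q + (t * q + n))    ≡⟨ cong a (sym (ℕ.+-assoc q (t * q) n)) ⟩
    a (q + t * q + n)      ∎

  log₂-bracket : ∀ n → ∃[ u ] (2 ^ u ≤ suc n × suc n < 2 ^ suc u)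
  log₂-bracket zero    = 0 , ℕ.≤-refl , ℕ.≤-refl
  log₂-bracket (suc n) with log₂-bracket n
  ... | u , l , h with suc (suc n) ℕ.<? 2 ^ suc u
  ...   | yes h′ = u , ℕ.≤-trans l (ℕ.n≤1+n _) , h′
  ...   | no  h′ = suc u , ℕ.≮⇒≥ h′ , (begin-strict
    suc (suc n)            ≤⟨ h ⟩
    2 ^ suc u              <⟨ ℕ.m<m+n (2 ^ suc u) (ℕ.m^n>0 2 (suc u)) ⟩
    2 ^ suc u + 2 ^ suc u  ≡⟨ cong (λ e → 2 ^ suc u + e) (sym (ℕ.+-identityʳ _)) ⟩
    2 ^ suc (suc u)        ∎)

  -- Sorted residues, their gaps and the hitting of all parts

  argmin : ∀ {n} (w : Fin (suc n) → ℕ) → ∃[ i ] (∀ j → w i ≤ w j)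
  argmin {zero}  w = zero , λ { zero → ℕ.≤-refl }
  argmin {suc n} w with argmin (λ j → w (suc j))
  ... | i , least with ℕ.≤-total (w zero) (w (suc i))
  ...   | inj₁ h = zero , λ { zero → ℕ.≤-refl ; (suc j) → ℕ.≤-trans h (least j) }
  ...   | inj₂ h = suc i , λ { zero → h ; (suc j) → least j }

  -- Selection sort: a minimiser `i` goes to position zero, and the other indices, enumerated by
  -- `punchIn i`, are sorted recursively. `σ ⟨$⟩ˡ j` is the index of the value at position `j`.
  sort : ∀ {n} (w : Fin n → ℕ) →
         Σ[ σ ∈ Permutation′ n ] (λ j → w (σ ⟨$⟩ˡ j)) Preserves Fin._≤_ ⟶ _≤_
  sort {zero}  w = id , λ { {()} }
  sort {suc n} w with argmin w
  ... | i , least with sort (λ j → w (punchIn i j))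
  ...   | σ , mono = insert i zero σ , λ
    { {zero}          _ → least _
    ; {suc j} {suc k} h → mono (s≤s⁻¹ h) }

  -- The part following the one that contains `y (inject₁ k)` holds a point, which comes later in
  -- the order. So the next point is at most two part lengths away.
  inner-gap : ∀ {n K b} .{{_ : NonZero b}} (y : Fin (suc n) → ℕ) → y Preserves Fin._≤_ ⟶ _≤_ →
              (∀ i → y i < K * b) →
              (∀ j → j < K → ∃[ i ] (j * b ≤ y i × y i < suc j * b)) →
              ∀ k → y (suc k) ≤ y (inject₁ k) + 2 * b
  inner-gap {n} {K} {b} y mono y< hit k with suc (y (inject₁ k) / b) ℕ.<? K
  ... | yes j<K = let i , l , u = hit _ j<K in begin
    y (suc k)                 ≤⟨ mono (ℕ.≰⇒> λ i≤k → ℕ.<⇒≱ (ℕ.<-≤-trans v< l)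
                                   (mono (subst (toℕ i ≤_) (sym (Fin.toℕ-inject₁ k)) i≤k))) ⟩
    y i                       ≤⟨ ℕ.<⇒≤ u ⟩
    suc (suc (v / b)) * b     ≡⟨ lem b (v / b) ⟩
    v / b * b + 2 * b         ≤⟨ ℕ.+-monoˡ-≤ (2 * b) (ℕ.m/n*n≤m v b) ⟩
    v + 2 * b                 ∎
    where
    v = y (inject₁ k)
    v< : v < suc (v / b) * b
    v< = m<[1+m/n]*n v b
    lem : ∀ b j → (1 + (1 + j)) * b ≡ j * b + 2 * b
    lem = solve-∀
  -- Here `y (inject₁ k)` is in the last part, so even the end `K * b` of the circle is at most `b`
  -- away.
  ... | no j≮K = begin
    y (suc k)                 ≤⟨ ℕ.<⇒≤ (y< (suc k)) ⟩
    K * b                     ≤⟨ ℕ.*-monoˡ-≤ b (ℕ.≮⇒≥ j≮K) ⟩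
    b + v / b * b             ≤⟨ ℕ.+-mono-≤ (ℕ.m≤m+n b (b + 0)) (ℕ.m/n*n≤m v b) ⟩
    2 * b + v                 ≡⟨ ℕ.+-comm (2 * b) v ⟩
    v + 2 * b                 ∎
    where v = y (inject₁ k)

  -- Both the last and the first part contain a point, so the gap across the end of the circle fits
  -- into these two parts.
  outer-gap : ∀ {n K b} (y : Fin (suc n) → ℕ) → y Preserves Fin._≤_ ⟶ _≤_ →
              (∀ j → j < suc K → ∃[ i ] (j * b ≤ y i × y i < suc j * b)) →
              suc K * b + y zero ≤ y (Fin.fromℕ n) + 2 * b
  outer-gap {n} {K} {b} y mono hit =
    let i , _ , u = hit 0 (s≤s z≤n)
        k , l , _ = hit K ℕ.≤-refl in begin
    b + K * b + y zero            ≤⟨ ℕ.+-mono-≤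
        (ℕ.+-monoʳ-≤ b (ℕ.≤-trans l (mono (Fin.≤fromℕ k))))
        (ℕ.≤-trans (mono {zero} {i} z≤n) (ℕ.<⇒≤ u)) ⟩
    b + y (Fin.fromℕ n) + (b + 0) ≡⟨ lem b (y (Fin.fromℕ n)) ⟩
    y (Fin.fromℕ n) + 2 * b       ∎
    where
    lem : ∀ b y → b + y + (b + 0) ≡ y + 2 * b
    lem = solve-∀

  -- Apply `nested` to the terms at 0, m, 2m, ...; exactly `K` of these indices are at most `n`, and
  -- `b` is the last such term. For α = x / (K b) the residue of `x * a i` modulo `K * b` is `K * b`
  -- times the fractional part of α a_i, so each part has length `b`.
  all-parts-hit : ∀ (a : ℕ → ℕ) → (∀ n → 0 < a n) → ∀ n m .{{_ : NonZero m}} →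
    let K = suc (n / m) ; b = a (n / m * m) in .{{_ : NonZero (K * b)}} →
    (∀ l → 2 * K * a l ≤ a (m + l)) →
    ∃[ x ] (∀ j → j < K → ∃[ i ] (j * b ≤ x * a (toℕ {suc n} i) % (K * b) ×
                                  x * a (toℕ {suc n} i) % (K * b) < suc j * b))
  all-parts-hit a a>0 n m grow
    with nested (suc (n / m)) (λ k → a (k * m)) (λ k → a>0 (k * m)) (λ k → grow (k * m))
                (n / m) ℕ.≤-refl
  ... | x , h = x , hit
    where
    K = suc (n / m)
    b = a (n / m * m)
    hit : ∀ j → j < K → ∃[ i ] (j * b ≤ x * a (toℕ {suc n} i) % (K * b) ×
                                x * a (toℕ {suc n} i) % (K * b) < suc j * b)
    hit j j<K with h j (s≤s⁻¹ j<K)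
    ... | p , l , u = fromℕ< jm<N , subst
      (λ i → j * b ≤ x * a i % (K * b) × x * a i % (K * b) < suc j * b)
      (sym (Fin.toℕ-fromℕ< jm<N))
      (%-part K b p j (x * a (j * m)) j<K l
        -- The upper bound from `nested` concerns `suc x`; positivity of `a` turns it into a strict
        -- one for `x`.
        (ℕ.<-≤-trans (ℕ.+-monoˡ-< (x * a (j * m)) (a>0 (j * m))) u))
      where
      jm<N : j * m < suc n
      jm<N = s≤s (ℕ.≤-trans (ℕ.*-monoˡ-≤ m (s≤s⁻¹ j<K)) (ℕ.m/n*n≤m n m))

-- Rational arithmetic with quotients of natural numbers

module Fractions where
  open import Data.Nat.Base using (_+_; _*_; _≤_; _<_)

  infixl 7 _÷_

  _÷_ : ℕ → (n : ℕ) → .{{_ : NonZero n}} → ℚ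
  m ÷ n = + m ℚ./ n

  -- `ℚ./` reduces to lowest terms. Passing to unnormalised fractions turns comparisons and
  -- identities into cross-multiplications.
  toℚᵘ-÷ : ∀ m n → ℚ.toℚᵘ (m ÷ suc n) ℚᵘ.≃ ℚᵘ.mkℚᵘ (+ m) n
  toℚᵘ-÷ m n = ℚ.toℚᵘ-fromℚᵘ (ℚᵘ.mkℚᵘ (+ m) n)

  ÷-mono-≤ : ∀ m n p q .{{_ : NonZero n}} .{{_ : NonZero q}} →
             m * q ≤ p * n → m ÷ n ℚ.≤ p ÷ q
  ÷-mono-≤ m (suc n) p (suc q) h = ℚ.toℚᵘ-cancel-≤
    (ℚᵘ.≤-respˡ-≃ (ℚᵘ.≃-sym (toℚᵘ-÷ m n))
    (ℚᵘ.≤-respʳ-≃ (ℚᵘ.≃-sym (toℚᵘ-÷ p q))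
      (ℚᵘ.*≤* (subst₂ ℤ._≤_ (ℤ.pos-* m (suc q)) (ℤ.pos-* p (suc n)) (ℤ.+≤+ h)))))

  ÷-cancel-≤ : ∀ m n p q .{{_ : NonZero n}} .{{_ : NonZero q}} →
               m ÷ n ℚ.≤ p ÷ q → m * q ≤ p * n
  ÷-cancel-≤ m (suc n) p (suc q) h = ℤ.drop‿+≤+
    (subst₂ ℤ._≤_ (sym (ℤ.pos-* m (suc q))) (sym (ℤ.pos-* p (suc n)))
      (ℚᵘ.drop-*≤*
        (ℚᵘ.≤-respˡ-≃ (toℚᵘ-÷ m n) (ℚᵘ.≤-respʳ-≃ (toℚᵘ-÷ p q) (ℚ.toℚᵘ-mono-≤ h)))))

  ÷-mono-< : ∀ m n p q .{{_ : NonZero n}} .{{_ : NonZero q}} →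
             m * q < p * n → m ÷ n ℚ.< p ÷ q
  ÷-mono-< m n p q h = ℚ.≰⇒> λ k → ℕ.<⇒≱ h (÷-cancel-≤ p q m n k)

  ÷-cong : ∀ m n p q .{{_ : NonZero n}} .{{_ : NonZero q}} →
           m * q ≡ p * n → m ÷ n ≡ p ÷ q
  ÷-cong m n p q h = ℚ.≤-antisym
    (÷-mono-≤ m n p q (ℕ.≤-reflexive h)) (÷-mono-≤ p q m n (ℕ.≤-reflexive (sym h)))

  ÷-+ : ∀ m n p q .{{_ : NonZero n}} .{{_ : NonZero q}} .{{_ : NonZero (n * q)}} →
        m ÷ n ℚ.+ p ÷ q ≡ (m * q + p * n) ÷ (n * q)
  ÷-+ m (suc n) p (suc q) = ℚ.toℚᵘ-injective (begin
    ℚ.toℚᵘ (m ÷ suc n ℚ.+ p ÷ suc q)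
      ≈⟨ ℚ.toℚᵘ-homo-+ (m ÷ suc n) (p ÷ suc q) ⟩
    ℚ.toℚᵘ (m ÷ suc n) ℚᵘ.+ ℚ.toℚᵘ (p ÷ suc q)
      ≈⟨ ℚᵘ.+-cong (toℚᵘ-÷ m n) (toℚᵘ-÷ p q) ⟩
    ℚᵘ.mkℚᵘ (+ m) n ℚᵘ.+ ℚᵘ.mkℚᵘ (+ p) q
      ≡⟨ cong (λ i → ℚᵘ.mkℚᵘ i (q + n * suc q))
           (cong₂ ℤ._+_ (ℤ.pos-* m (suc q)) (ℤ.pos-* p (suc n))) ⟨
    ℚᵘ.mkℚᵘ (+ (m * suc q + p * suc n)) (q + n * suc q)
      ≈⟨ toℚᵘ-÷ (m * suc q + p * suc n) (q + n * suc q) ⟨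
    ℚ.toℚᵘ ((m * suc q + p * suc n) ÷ (suc n * suc q)) ∎)
    where open ℚᵘ.≃-Reasoning

  ÷-* : ∀ m n p q .{{_ : NonZero n}} .{{_ : NonZero q}} .{{_ : NonZero (n * q)}} →
        (m ÷ n) ℚ.* (p ÷ q) ≡ (m * p) ÷ (n * q)
  ÷-* m (suc n) p (suc q) = ℚ.toℚᵘ-injective (begin
    ℚ.toℚᵘ ((m ÷ suc n) ℚ.* (p ÷ suc q))
      ≈⟨ ℚ.toℚᵘ-homo-* (m ÷ suc n) (p ÷ suc q) ⟩
    ℚ.toℚᵘ (m ÷ suc n) ℚᵘ.* ℚ.toℚᵘ (p ÷ suc q)
      ≈⟨ ℚᵘ.*-cong (toℚᵘ-÷ m n) (toℚᵘ-÷ p q) ⟩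
    ℚᵘ.mkℚᵘ (+ m) n ℚᵘ.* ℚᵘ.mkℚᵘ (+ p) q
      ≡⟨ cong (λ i → ℚᵘ.mkℚᵘ i (q + n * suc q)) (ℤ.pos-* m p) ⟨
    ℚᵘ.mkℚᵘ (+ (m * p)) (q + n * suc q)
      ≈⟨ toℚᵘ-÷ (m * p) (q + n * suc q) ⟨
    ℚ.toℚᵘ ((m * p) ÷ (suc n * suc q)) ∎)
    where open ℚᵘ.≃-Reasoning

  ÷-+-common : ∀ m p n .{{_ : NonZero n}} → m ÷ n ℚ.+ p ÷ n ≡ (m + p) ÷ n
  ÷-+-common m p n@(suc _) = trans (÷-+ m n p n)
    (÷-cong (m * n + p * n) (n * n) (m + p) n (lem m p n))
    where
    lem : ∀ m p n → (m * n + p * n) * n ≡ (m + p) * (n * n)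
    lem = solve-∀

  archimedean : ∀ {ε} → 0ℚ ℚ.< ε → ∃[ d ] (1 ÷ suc d ℚ.≤ ε)
  archimedean {mkℚ (+ suc i) d c} ε>0 = d ,
    subst (1 ÷ suc d ℚ.≤_) (ℚ.fromℚᵘ-toℚᵘ (mkℚ (+ suc i) d c))
      (÷-mono-≤ 1 (suc d) (suc i) (suc d) (ℕ.*-monoˡ-≤ (suc d) {1} {suc i} (s≤s z≤n)))
  archimedean {mkℚ (+ 0)      _ _} (*<* (ℤ.+<+ ()))
  archimedean {mkℚ ℤ.-[1+ _ ] _ _} (*<* ())

  p≤q+r⇒p-q≤r : ∀ p q {r} → p ℚ.≤ q ℚ.+ r → p ℚ.- q ℚ.≤ r
  p≤q+r⇒p-q≤r p q {r} h = subst (p ℚ.- q ℚ.≤_) (lem q r) (ℚ.+-monoˡ-≤ (ℚ.- q) h)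
    where
    lem : ∀ q r → q ℚ.+ r ℚ.- q ≡ r
    lem = solve 2 (λ q r → q :+ r :- q := r) refl

open import Defs
open Arithmetic
open Fractions

-- Lower bound for the logarithm

reciprocals-+ : ∀ m n o → reciprocals m (n ℕ.+ o) ≡ reciprocals m n ℚ.+ reciprocals (m ℕ.+ n) o
reciprocals-+ m n zero    = trans (cong (reciprocals m) (ℕ.+-identityʳ n)) (sym (ℚ.+-identityʳ _))
reciprocals-+ m n (suc o) = trans (cong (reciprocals m) (ℕ.+-suc n o))
  (trans (cong₂ ℚ._+_ (reciprocals-+ m n o) (cong (λ k → 1 ÷ suc k) (sym (ℕ.+-assoc m n o))))
         (ℚ.+-assoc (reciprocals m n) (reciprocals (m ℕ.+ n) o) _))

reciprocals-lower : ∀ m n d .{{_ : NonZero d}} → m ℕ.+ n ℕ.≤ d → n ÷ d ℚ.≤ reciprocals m n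
reciprocals-lower m zero    d h = ÷-mono-≤ 0 d 0 1 z≤n
reciprocals-lower m (suc n) d h = subst (ℚ._≤ reciprocals m (suc n))
  (trans (÷-+-common n 1 d) (cong (_÷ d) (ℕ.+-comm n 1)))
  (ℚ.+-mono-≤ (reciprocals-lower m n d (ℕ.≤-trans (ℕ.n≤1+n _) h′))
    (÷-mono-≤ 1 d 1 (suc (m ℕ.+ n)) (ℕ.*-monoʳ-≤ 1 h′)))
  where h′ = subst (ℕ._≤ d) (ℕ.+-suc m n) h

reciprocals≥0 : ∀ m n → 0ℚ ℚ.≤ reciprocals m n
reciprocals≥0 m n = ℚ.≤-trans (÷-mono-≤ 0 1 n (suc (m ℕ.+ n)) z≤n)
  (reciprocals-lower m n (suc (m ℕ.+ n)) (ℕ.n≤1+n _))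

-- Oresme's argument for the harmonic series: the ranges (m, 2m], (2m, 4m], ... each contribute at
-- least m / (2m) = 1/2, and `u` of them fit up to `m + n`.
reciprocals-dyadic : ∀ u m .{{_ : NonZero m}} n → 2 ℕ.^ u ℕ.* m ℕ.≤ m ℕ.+ n →
                     u ÷ 2 ℚ.≤ reciprocals m n
reciprocals-dyadic zero    m n h = reciprocals≥0 m n
reciprocals-dyadic (suc u) m@(suc _) n h =
  subst₂ ℚ._≤_ (÷-+-common 1 u 2)
    (trans (sym (reciprocals-+ m m (n ℕ.∸ m))) (cong (reciprocals m) m+[n∸m]≡n))
    (ℚ.+-mono-≤
      (ℚ.≤-trans (÷-mono-≤ 1 2 m (m ℕ.+ m) (ℕ.≤-reflexive (half m)))
        (reciprocals-lower m m (m ℕ.+ m) ℕ.≤-refl))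
      (reciprocals-dyadic u (m ℕ.+ m) (n ℕ.∸ m) (begin
        2 ℕ.^ u ℕ.* (m ℕ.+ m)         ≡⟨ double (2 ℕ.^ u) m ⟩
        2 ℕ.^ suc u ℕ.* m             ≤⟨ h ⟩
        m ℕ.+ n                       ≡⟨ cong (m ℕ.+_) m+[n∸m]≡n ⟨
        m ℕ.+ (m ℕ.+ (n ℕ.∸ m))       ≡⟨ ℕ.+-assoc m m (n ℕ.∸ m) ⟨
        m ℕ.+ m ℕ.+ (n ℕ.∸ m)         ∎)))
  where
  open ℕ.≤-Reasoning
  half : ∀ m → 1 ℕ.* (m ℕ.+ m) ≡ m ℕ.* 2
  half = solve-∀
  double : ∀ e m → e ℕ.* (m ℕ.+ m) ≡ 2 ℕ.* e ℕ.* m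
  double = solve-∀
  m≤n : m ℕ.≤ n
  m≤n = ℕ.+-cancelˡ-≤ m m n (begin
    m ℕ.+ m              ≡⟨ cong (m ℕ.+_) (sym (ℕ.+-identityʳ m)) ⟩
    2 ℕ.* m              ≤⟨ ℕ.*-monoˡ-≤ m (ℕ.*-monoʳ-≤ 2 (ℕ.m^n>0 2 u)) ⟩
    2 ℕ.^ suc u ℕ.* m    ≤⟨ h ⟩
    m ℕ.+ n              ∎)
  m+[n∸m]≡n : m ℕ.+ (n ℕ.∸ m) ≡ n
  m+[n∸m]≡n = ℕ.m+[n∸m]≡n m≤n

-- The bound holds for every Riemann sum, not only in the limit, so that reals can later be compared
-- term by term.
log-lower : ∀ u N .{{_ : NonZero N}} → 2 ℕ.^ u ℕ.≤ N → ∀ k → u ÷ 2 ℚ.≤ seq (log N) k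
log-lower u (suc n) h k = reciprocals-dyadic u (suc k) (n ℕ.* suc k) (ℕ.*-monoˡ-≤ (suc k) h)

-- Termwise comparison of reals and of the maximal gap

≤-pointwise : ∀ {x y} → (∀ n → seq x n ℚ.≤ seq y n) → x ≤ y
≤-pointwise {x} {y} h ε ε>0 = 0 , λ n _ →
  ℚ.≤-trans (h n) (subst (ℚ._≤ seq y n ℚ.+ ε) (ℚ.+-identityʳ (seq y n))
    (ℚ.+-monoʳ-≤ (seq y n) (ℚ.<⇒≤ ε>0)))

≈-pointwise : ∀ {x y} → (∀ n → seq x n ≡ seq y n) → x ≈ y
≈-pointwise {x} {y} h ε ε>0 = 0 , λ n _ →
  subst (ℚ._< ε) (sym (cong ℚ.∣_∣ (trans (cong (ℚ._- seq y n) (h n)) (ℚ.+-inverseʳ (seq y n))))) ε>0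

seq-maximum-≤ : ∀ {n} (v : Vector ℝ (suc n)) k {q} →
                (∀ i → seq (v i) k ℚ.≤ q) → seq (maximum v) k ℚ.≤ q
seq-maximum-≤ v k {q} h = fold (v zero) (λ i → v (suc i)) (h zero) (λ i → h (suc i))
  where
  fold : ∀ {n} e (v : Vector ℝ n) → seq e k ℚ.≤ q → (∀ i → seq (v i) k ℚ.≤ q) →
         seq (foldr _⊔_ e v) k ℚ.≤ q
  fold {zero}  e v h₀ h = h₀
  fold {suc n} e v h₀ h = ℚ.⊔-lub (h zero) (fold e (λ i → v (suc i)) h₀ (λ i → h (suc i)))

G-≤ : ∀ {n k q} {z : Vector ℝ (suc n)} (s : SortedMod1 z) → let y = SortedMod1.y s in
      (∀ i → seq (y (suc i)) k ℚ.≤ seq (y (inject₁ i)) k ℚ.+ q) →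
      1 ÷ 1 ℚ.+ seq (y zero) k ℚ.≤ seq (y (Fin.fromℕ n)) k ℚ.+ q →
      seq (G s) k ℚ.≤ q
G-≤ {n} {k} {q} s inner outer = seq-maximum-≤
  (λ i → wrapAround y (suc i) - wrapAround y (inject₁ i)) k
  λ i → p≤q+r⇒p-q≤r (seq (wrapAround y (suc i)) k) (seq (wrapAround y (inject₁ i)) k) (gap i)
  where
  open SortedMod1 s
  wrap-inject₁ : ∀ i → wrapAround y (inject₁ i) ≡ y i
  wrap-inject₁ i rewrite view-inject₁ i = refl
  gap : ∀ i → seq (wrapAround y (suc i)) k ℚ.≤ seq (wrapAround y (inject₁ i)) k ℚ.+ q
  gap i rewrite wrap-inject₁ i with view i
  -- The last `i` gives the gap that crosses 1; every other `i` gives an ordinary gap.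
  ... | ‵fromℕ     = outer
  ... | ‵inject₁ j = inner j

-- Integral form of the growth condition

integral-growth : ∀ r → 1ℝ < r →
  ∃[ d ] (∀ a → Lacunary r a → ∀ n → suc (suc d) ℕ.* a n ℕ.≤ suc d ℕ.* a (suc n))
integral-growth r (ε , ε>0 , M , 1+ε≤r) with archimedean ε>0
... | d , 1/q≤ε = d , λ a lac n → growth a n
  -- An inequality of reals holds only up to positive slack. Slack 1/(2q) together with 1 + 1/q ≤ r
  -- gives, after multiplication by q, (q + 1) a_n ≤ q a_(n+1) + 1/2; between integers the 1/2
  -- disappears.
  (lac n (1 ÷ (2 ℕ.* suc d)) (÷-mono-< 0 1 1 (2 ℕ.* suc d) (s≤s z≤n)))
  where
  q = suc d
  growth : ∀ a n → ∃[ M′ ] (∀ m → M′ ℕ.≤ m →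
             seq r m ℚ.* (a n ÷ 1) ℚ.≤ a (suc n) ÷ 1 ℚ.+ 1 ÷ (2 ℕ.* q)) →
           suc q ℕ.* a n ℕ.≤ q ℕ.* a (suc n)
  growth a n (M′ , h) = ℕ.≮⇒≥ λ B<A → ℕ.<⇒≱
      (subst (ℕ._≤ 2 ℕ.* A) (lem B) (ℕ.*-monoʳ-≤ 2 B<A))
      (ℕ.*-cancelʳ-≤ (2 ℕ.* A) (2 ℕ.* B ℕ.+ 1) q
        (subst₂ ℕ._≤_ (lemˡ q (a n)) (lemʳ q (a (suc n)))
          (÷-cancel-≤ numˡ (1 ℕ.* q ℕ.* 1) numʳ (1 ℕ.* (2 ℕ.* q)) fractions)))
    where
    A = suc q ℕ.* a n
    B = q ℕ.* a (suc n)
    lem : ∀ B → 2 ℕ.* (1 ℕ.+ B) ≡ 1 ℕ.+ (2 ℕ.* B ℕ.+ 1)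
    lem = solve-∀
    lemˡ : ∀ q a → (1 ℕ.* q ℕ.+ 1 ℕ.* 1) ℕ.* a ℕ.* (1 ℕ.* (2 ℕ.* q)) ≡ 2 ℕ.* ((1 ℕ.+ q) ℕ.* a) ℕ.* q
    lemˡ = solve-∀
    lemʳ : ∀ q a → (a ℕ.* (2 ℕ.* q) ℕ.+ 1 ℕ.* 1) ℕ.* (1 ℕ.* q ℕ.* 1) ≡ (2 ℕ.* (q ℕ.* a) ℕ.+ 1) ℕ.* q
    lemʳ = solve-∀
    ineq : (1 ÷ 1 ℚ.+ 1 ÷ q) ℚ.* (a n ÷ 1) ℚ.≤ a (suc n) ÷ 1 ℚ.+ 1 ÷ (2 ℕ.* q)
    ineq = ℚ.≤-trans
      (ℚ.*-monoʳ-≤-nonNeg (a n ÷ 1) {{ℚ.nonNegative (÷-mono-≤ 0 1 (a n) 1 z≤n)}}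
        (ℚ.≤-trans (ℚ.+-monoʳ-≤ (1 ÷ 1) 1/q≤ε) (1+ε≤r (M ℕ.⊔ M′) (ℕ.m≤m⊔n M M′))))
      (h (M ℕ.⊔ M′) (ℕ.m≤n⊔m M M′))
    numˡ = (1 ℕ.* q ℕ.+ 1 ℕ.* 1) ℕ.* a n
    numʳ = a (suc n) ℕ.* (2 ℕ.* q) ℕ.+ 1 ℕ.* 1
    fractions : numˡ ÷ (1 ℕ.* q ℕ.* 1) ℚ.≤ numʳ ÷ (1 ℕ.* (2 ℕ.* q))
    fractions = subst₂ ℚ._≤_
      (trans (cong (ℚ._* (a n ÷ 1)) (÷-+ 1 1 1 q)) (÷-* (1 ℕ.* q ℕ.+ 1 ℕ.* 1) (1 ℕ.* q) (a n) 1))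
      (÷-+ (a (suc n)) 1 1 (2 ℕ.* q))
      ineq

-- Fractional parts of rational multiples and their gaps

sortedMod1 : ∀ {N} (c : Fin N → ℕ) α x D .{{_ : NonZero D}} → (∀ k → seq α k ≡ x ÷ D) →
             (σ : Permutation′ N) →
             (λ j → x ℕ.* c (σ ⟨$⟩ˡ j) ℕ.% D) Preserves Fin._≤_ ⟶ ℕ._≤_ →
             SortedMod1 (λ i → α * fromℕ (c i))
sortedMod1 c α x D α≡x÷D σ mono = record
  -- For α = x / D, division of `x * c i` by `D` yields both the integer part and `D` times the
  -- fractional part, so sorting residues sorts the representatives.
  { y      = λ j → fromℚ (w (σ ⟨$⟩ˡ j) ÷ D)
  ; ⌊_⌋    = λ i → + (x ℕ.* c i ℕ./ D)
  ; σ      = σ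
  ; y-mod1 = λ i → ≈-pointwise {fromℚ (w (σ ⟨$⟩ˡ (σ ⟨$⟩ʳ i)) ÷ D)}
      {α * fromℕ (c i) - fromℤ (+ (x ℕ.* c i ℕ./ D))}
      λ k → trans (cong (λ k → w k ÷ D) (inverseˡ σ)) (trans (remainder i)
        (cong (λ e → e ℚ.* (c i ÷ 1) ℚ.- (x ℕ.* c i ℕ./ D) ÷ 1) (sym (α≡x÷D k))))
  ; 0≤y    = λ j → ≤-pointwise {0ℝ} {fromℚ (w (σ ⟨$⟩ˡ j) ÷ D)}
      λ _ → ÷-mono-≤ 0 1 (w (σ ⟨$⟩ˡ j)) D z≤n
  -- Strict inequality of reals requires a margin; residues are at most D - 1, so 1 / D serves.
  ; y<1    = λ j → 1 ÷ D , ÷-mono-< 0 1 1 D (s≤s z≤n) , 0 , λ _ _ →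
      subst (ℚ._≤ 1 ÷ 1) (sym (÷-+-common (w (σ ⟨$⟩ˡ j)) 1 D))
        (÷-mono-≤ (w (σ ⟨$⟩ˡ j) ℕ.+ 1) D 1 1
          (subst₂ ℕ._≤_ (lem (w (σ ⟨$⟩ˡ j))) (sym (ℕ.*-identityˡ D))
            (ℕ.m%n<n (x ℕ.* c (σ ⟨$⟩ˡ j)) D)))
  ; sorted = λ {j} {k} j≤k → ≤-pointwise {fromℚ (w (σ ⟨$⟩ˡ j) ÷ D)} {fromℚ (w (σ ⟨$⟩ˡ k) ÷ D)}
      λ _ → ÷-mono-≤ (w (σ ⟨$⟩ˡ j)) D (w (σ ⟨$⟩ˡ k)) D (ℕ.*-monoˡ-≤ D (mono j≤k))
  }
  where
  w : Fin _ → ℕ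
  w i = x ℕ.* c i ℕ.% D
  lem : ∀ w → 1 ℕ.+ w ≡ (w ℕ.+ 1) ℕ.* 1
  lem = solve-∀
  remainder : ∀ i → w i ÷ D ≡ (x ÷ D) ℚ.* (c i ÷ 1) ℚ.- (x ℕ.* c i ℕ./ D) ÷ 1
  remainder i = begin
    w i ÷ D                              ≡⟨ rearrange (w i ÷ D) (f ÷ 1) ⟩
    w i ÷ D ℚ.+ f ÷ 1 ℚ.- f ÷ 1          ≡⟨ cong (ℚ._- f ÷ 1) (begin
      w i ÷ D ℚ.+ f ÷ 1                    ≡⟨ ÷-+ (w i) D f 1 ⟩
      (w i ℕ.* 1 ℕ.+ f ℕ.* D) ÷ (D ℕ.* 1)  ≡⟨ cong (λ e → e ÷ (D ℕ.* 1)) (trans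
        (cong (ℕ._+ f ℕ.* D) (ℕ.*-identityʳ (w i))) (sym (ℕ.m≡m%n+[m/n]*n (x ℕ.* c i) D))) ⟩
      (x ℕ.* c i) ÷ (D ℕ.* 1)              ≡⟨ ÷-* x D (c i) 1 ⟨
      (x ÷ D) ℚ.* (c i ÷ 1)                ∎) ⟩
    (x ÷ D) ℚ.* (c i ÷ 1) ℚ.- f ÷ 1      ∎
    where
    open ≡-Reasoning
    f = x ℕ.* c i ℕ./ D
    instance
      D*1≢0 : NonZero (D ℕ.* 1)
      D*1≢0 = ℕ.m*n≢0 D 1
    rearrange : ∀ p q → p ≡ p ℚ.+ q ℚ.- q
    rearrange = solve 2 (λ p q → p := p :+ q :- q) refl

-- In units of 1 / D the circle has length `K * b` and its parts have length `b`; the integer bound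
-- `2 * b` on all gaps becomes 2b / D = 2 / K.
sortedMod1-gap : ∀ {n} (c : Fin (suc n) → ℕ) α x K b D z
  .{{_ : NonZero K}} .{{_ : NonZero b}} .{{_ : NonZero D}} → D ≡ K ℕ.* b → (∀ k → seq α k ≡ x ÷ D) →
  (∀ j → j ℕ.< K → ∃[ i ] (j ℕ.* b ℕ.≤ x ℕ.* c i ℕ.% D × x ℕ.* c i ℕ.% D ℕ.< suc j ℕ.* b)) →
  (∀ k → (2 ℕ.* b) ÷ D ℚ.≤ seq z k) →
  Σ[ s ∈ SortedMod1 (λ i → α * fromℕ (c i)) ] G s ≤ z
sortedMod1-gap {n} c α x (suc K) b D z D≡Kb α≡x÷D hit bound = s ,
  ≤-pointwise {G s} {z} λ k → ℚ.≤-trans (G-≤ {n} {k} {(2 ℕ.* b) ÷ D} s inner outer) (bound k)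
  where
  w : Fin (suc n) → ℕ
  w i = x ℕ.* c i ℕ.% D
  σ : Permutation′ (suc n)
  σ = proj₁ (sort w)
  y : Fin (suc n) → ℕ
  y j = w (σ ⟨$⟩ˡ j)
  mono : y Preserves Fin._≤_ ⟶ ℕ._≤_
  mono = proj₂ (sort w)
  s : SortedMod1 (λ i → α * fromℕ (c i))
  s = sortedMod1 c α x D α≡x÷D σ mono
  hit-y : ∀ j → j ℕ.< suc K → ∃[ i ] (j ℕ.* b ℕ.≤ y i × y i ℕ.< suc j ℕ.* b)
  hit-y j j<K = let i , l , u = hit j j<K in σ ⟨$⟩ʳ i ,
    subst (λ i′ → j ℕ.* b ℕ.≤ w i′ × w i′ ℕ.< suc j ℕ.* b) (sym (inverseˡ σ)) (l , u)
  y<Kb : ∀ i → y i ℕ.< suc K ℕ.* b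
  y<Kb i = subst (y i ℕ.<_) D≡Kb (ℕ.m%n<n (x ℕ.* c (σ ⟨$⟩ˡ i)) D)
  inner : ∀ i → y (suc i) ÷ D ℚ.≤ y (inject₁ i) ÷ D ℚ.+ (2 ℕ.* b) ÷ D
  inner i = subst (y (suc i) ÷ D ℚ.≤_) (sym (÷-+-common (y (inject₁ i)) (2 ℕ.* b) D))
    (÷-mono-≤ (y (suc i)) D (y (inject₁ i) ℕ.+ 2 ℕ.* b) D (ℕ.*-monoˡ-≤ D
      (inner-gap {K = suc K} y mono y<Kb hit-y i)))
  outer : 1 ÷ 1 ℚ.+ y zero ÷ D ℚ.≤ y (Fin.fromℕ n) ÷ D ℚ.+ (2 ℕ.* b) ÷ D
  outer = subst₂ ℚ._≤_
    (trans (sym (÷-+-common D (y zero) D))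
      (cong (ℚ._+ y zero ÷ D) (÷-cong D D 1 1 (ℕ.*-comm D 1))))
    (sym (÷-+-common (y (Fin.fromℕ n)) (2 ℕ.* b) D))
    (÷-mono-≤ (D ℕ.+ y zero) D (y (Fin.fromℕ n) ℕ.+ 2 ℕ.* b) D (ℕ.*-monoˡ-≤ D
      (subst (λ e → e ℕ.+ y zero ℕ.≤ y (Fin.fromℕ n) ℕ.+ 2 ℕ.* b) (sym D≡Kb)
        (outer-gap y mono hit-y))))

-- Comparison with log N / N and choice of parameters

÷≤C*log/N : ∀ e D C u N .{{_ : NonZero D}} .{{_ : NonZero N}} → 2 ℕ.^ u ℕ.≤ N →
            e ℕ.* (2 ℕ.* N) ℕ.≤ C ℕ.* u ℕ.* D →
            ∀ k → e ÷ D ℚ.≤ seq (fromℕ C * log N / N) k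
÷≤C*log/N e D C u N@(suc _) 2ᵘ≤N h k = begin
  -- The hypothesis is e / D ≤ C u / (2N) with denominators cleared; it suffices because u / 2
  -- bounds log N from below.
  e ÷ D                                       ≤⟨ ÷-mono-≤ e D (C ℕ.* u) (2 ℕ.* N) h ⟩
  (C ℕ.* u) ÷ (2 ℕ.* N)                       ≡⟨ fractions ⟨
  (C ÷ 1) ℚ.* (u ÷ 2) ℚ.* (1 ÷ N)             ≤⟨ ℚ.*-monoʳ-≤-nonNeg (1 ÷ N) {{1/N≥0}}
    (ℚ.*-monoˡ-≤-nonNeg (C ÷ 1) {{C≥0}} (log-lower u N 2ᵘ≤N k)) ⟩
  (C ÷ 1) ℚ.* seq (log N) k ℚ.* (1 ÷ N)       ∎
  where
  open ℚ.≤-Reasoning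
  C≥0 : ℚ.NonNegative (C ÷ 1)
  C≥0 = ℚ.nonNegative (÷-mono-≤ 0 1 C 1 z≤n)
  1/N≥0 : ℚ.NonNegative (1 ÷ N)
  1/N≥0 = ℚ.nonNegative (÷-mono-≤ 0 1 1 N z≤n)
  fractions : (C ÷ 1) ℚ.* (u ÷ 2) ℚ.* (1 ÷ N) ≡ (C ℕ.* u) ÷ (2 ℕ.* N)
  fractions = trans (cong (ℚ._* (1 ÷ N)) (÷-* C 1 u 2))
    (trans (÷-* (C ℕ.* u) 2 1 N) (cong (_÷ (2 ℕ.* N)) (ℕ.*-identityʳ (C ℕ.* u))))

small-gap : ∀ q .{{_ : NonZero q}} (a : ℕ → ℕ) → (∀ n → 0 ℕ.< a n) →
  (∀ n → suc q ℕ.* a n ℕ.≤ q ℕ.* a (suc n)) →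
  ∀ n u → 0 ℕ.< u → 2 ℕ.^ u ℕ.≤ suc n → suc n ℕ.< 2 ℕ.^ suc u →
  Σ[ α ∈ ℝ ] Σ[ s ∈ SortedMod1 (λ (i : Fin (suc n)) → α * fromℕ (a (toℕ i))) ]
    G s ≤ fromℕ (12 ℕ.* q) * log (suc n) / suc n
small-gap q a a>0 growth n u 0<u 2ᵘ≤N N<2ᵘ⁺¹ = α ,
  sortedMod1-gap (λ i → a (toℕ i)) α (proj₁ hits) K b (K ℕ.* b)
    (fromℕ (12 ℕ.* q) * log (suc n) / suc n) refl (λ _ → refl) (proj₂ hits)
    (÷≤C*log/N (2 ℕ.* b) (K ℕ.* b) (12 ℕ.* q) u (suc n) 2ᵘ≤N bound)
  where
  open ℕ.≤-Reasoning
  -- Each `q` indices double the terms, so `m` indices gain the factor 2^(2+u) = 2 · 2^(u+1), which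
  -- exceeds 2N and hence 2K.
  m = (2 ℕ.+ u) ℕ.* q
  instance
    m≢0 : NonZero m
    m≢0 = ℕ.m*n≢0 (2 ℕ.+ u) q
  K = suc (n ℕ./ m)
  b = a (n ℕ./ m ℕ.* m)
  instance
    b≢0 : NonZero b
    b≢0 = ℕ.>-nonZero (a>0 (n ℕ./ m ℕ.* m))
    Kb≢0 : NonZero (K ℕ.* b)
    Kb≢0 = ℕ.m*n≢0 K b

  grow : ∀ l → 2 ℕ.* K ℕ.* a l ℕ.≤ a (m ℕ.+ l)
  grow l = ℕ.≤-trans
    (ℕ.*-monoˡ-≤ (a l) (ℕ.*-monoʳ-≤ 2 (ℕ.≤-trans (s≤s (ℕ.m/n≤m n m)) (ℕ.<⇒≤ N<2ᵘ⁺¹))))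
    (doublings q a (doubling q a growth) (2 ℕ.+ u) l)

  hits = all-parts-hit a a>0 n m grow

  α : ℝ
  α = fromℚ (proj₁ hits ÷ (K ℕ.* b))

  -- Origin of the constant 12: N ≤ K m, and m ≤ 3 u q because u ≥ 1, so 4 N ≤ 12 q u K.
  bound : 2 ℕ.* b ℕ.* (2 ℕ.* suc n) ℕ.≤ 12 ℕ.* q ℕ.* u ℕ.* (K ℕ.* b)
  bound = begin
    2 ℕ.* b ℕ.* (2 ℕ.* suc n)
      ≤⟨ ℕ.*-monoʳ-≤ (2 ℕ.* b) (ℕ.*-monoʳ-≤ 2 (m<[1+m/n]*n n m)) ⟩
    2 ℕ.* b ℕ.* (2 ℕ.* (K ℕ.* m))
      ≤⟨ ℕ.*-monoʳ-≤ (2 ℕ.* b) (ℕ.*-monoʳ-≤ 2 (ℕ.*-monoʳ-≤ K (ℕ.*-monoˡ-≤ q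
           (ℕ.+-monoˡ-≤ u (ℕ.*-monoʳ-≤ 2 {1} {u} 0<u))))) ⟩
    2 ℕ.* b ℕ.* (2 ℕ.* (K ℕ.* ((2 ℕ.* u ℕ.+ u) ℕ.* q)))
      ≡⟨ lem b K u q ⟩
    12 ℕ.* q ℕ.* u ℕ.* (K ℕ.* b) ∎
    where
    lem : ∀ b K u q → 2 ℕ.* b ℕ.* (2 ℕ.* (K ℕ.* ((2 ℕ.* u ℕ.+ u) ℕ.* q))) ≡
                      12 ℕ.* q ℕ.* u ℕ.* (K ℕ.* b)
    lem = solve-∀

theorem2p1 : (r : ℝ) → 1ℝ < r →
    Σ[ N₀ ∈ ℕ ] Σ[ C ∈ ℝ ] (0ℝ < C ×
    ((a : ℕ → ℕ) → (∀ n → 0 ℕ.< a n) → a Preserves ℕ._<_ ⟶ ℕ._<_ → Lacunary r a →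
    (N : ℕ) → .{{_ : NonZero N}} → N₀ ℕ.≤ N →
    Σ[ α ∈ ℝ ] Σ[ s ∈ SortedMod1 (λ (i : Fin N) → α * fromℕ (a (toℕ i))) ]
    G s ≤ C * log N / N))
-- From N = 2 on, the exponent `u` is positive. At N = 1 the bound fails, since log 1 = 0 while a
-- single point leaves a gap of 1.
theorem2p1 r 1<r = 2 , fromℕ (12 ℕ.* q) , C>0 , main
  where
  q = suc (proj₁ (integral-growth r 1<r))
  C>0 : 0ℝ < fromℕ (12 ℕ.* q)
  C>0 = 1 ÷ 1 , ÷-mono-< 0 1 1 1 (s≤s z≤n) , 0 , λ _ _ → ÷-mono-≤ 1 1 (12 ℕ.* q) 1 (s≤s z≤n)
  main : (a : ℕ → ℕ) → (∀ n → 0 ℕ.< a n) → a Preserves ℕ._<_ ⟶ ℕ._<_ → Lacunary r a →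
    (N : ℕ) → .{{_ : NonZero N}} → 2 ℕ.≤ N →
    Σ[ α ∈ ℝ ] Σ[ s ∈ SortedMod1 (λ (i : Fin N) → α * fromℕ (a (toℕ i))) ]
      G s ≤ fromℕ (12 ℕ.* q) * log N / N
  main a a>0 _ lac (suc n) 2≤N =
    let u , 2ᵘ≤N , N<2ᵘ⁺¹ = log₂-bracket n in
    small-gap q a a>0 (proj₂ (integral-growth r 1<r) a lac) n u (u>0 u N<2ᵘ⁺¹) 2ᵘ≤N N<2ᵘ⁺¹
    where
    u>0 : ∀ u → suc n ℕ.< 2 ℕ.^ suc u → 0 ℕ.< u
    u>0 zero    N<2 = ⊥-elim (ℕ.<⇒≱ N<2 2≤N)
    u>0 (suc u) _   = s≤s z≤n
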